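{- Let $n>2$ be an integer, let $K$ be an arbitrary group of order $n$ with identity element $e_K$, let $w$ be an arbitrary non-identity element of $K$, and let $H=S_2\wr K$ be the wreath product, whose elements are the triples $(g;k_1,k_2)$ with $g\in S_2$, $k_1,k_2\in K$, with multiplication $(g;k_1,k_2)(g';k'_1,k'_2)=(gg';\,k_1k'_{1^g},\,k_2k'_{2^g})$. Let $e$ denote the identity of $S_2$ and $\pi=(1,2)$ the transposition in $S_2$, and put $$A=\{(e;u,u): u\in K,\ u\neq e_K\},\quad B=\{(e;e_K,u): u\in K,\ u\neq e_K\},$$ $$C=\{(\pi;u,e_K): u\in K\},\quad D=\{(\pi;u,w): u\in K\}.$$ Let $Y=A\cup B\cup C\cup D$. Then the Cayley digraph $\mathrm{Cay}(H,Y)$ is a directed strongly regular graph with parameter set $(2n^2,\,4n-2,\,2n+2,\,n+2,\,6)$.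
   Context: $S_2$ is the symmetric group on $\{1,2\}$, and $1^g,2^g$ denote the images of $1,2$ under $g\in S_2$. For a finite group $H$ and a subset $X\subseteq H$ not containing the identity, the Cayley digraph $\mathrm{Cay}(H,X)$ has vertex set $H$ and dart (arc) set $\{(x,y): x,y\in H,\ yx^{ -1}\in X\}$. A directed strongly regular graph (DSRG) with parameter set $(N,k,t,\lambda,\mu)$ (in this order) is a loopless directed graph on $N$ vertices that is regular of valency $k$ (every vertex has in-degree and out-degree $k$), such that every vertex is incident with exactly $t$ undirected edges (an undirected edge is a pair of opposite arcs), and for any two distinct vertices $x,y$ the number of directed paths of length 2 from $x$ to $y$ is $\lambda$ if there is an arc from $x$ to $y$ and $\mu$ otherwise. Equivalently, its adjacency matrix $A$ (with zero diagonal) satisfies $AJ=JA=kJ$ and $A^2=tI+\lambda A+\mu(J-I-A)$, where $J$ is the all-one matrix and $I$ the identity matrix. -}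

module Defs where

open import Algebra.Bundles using (Group)
open import Data.Fin.Base using (Fin)
open import Data.Fin.Patterns using (0F; 1F)
open import Data.Fin.Permutation as Perm using (Permutation′; _⟨$⟩ʳ_; _⟨$⟩ˡ_; _∘ₚ_)
open import Data.Nat.Base using (ℕ)
open import Data.Product.Base using (_×_; _,_; ∃; proj₁)
open import Data.Sum.Base using (_⊎_; inj₁; inj₂)
open import Data.Vec.Functional using (Vector; _∷_; [])
open import Function.Bundles using (Inverse)
open import Level using (Level; suc; _⊔_)
open import Relation.Binary.Bundles using (Setoid)
open import Relation.Binary.Core using (Rel)
open import Relation.Binary.Definitions using (_Respects_; _Respects₂_)
import Relation.Binary.Construct.On as On
open import Relation.Binary.PropositionalEquality as ≡ using (_≡_)
open import Relation.Nullary.Negation.Core using (¬_)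
open import Relation.Unary using (Pred; _∪_)

-- A setoid has size n when its equality classes are in bijection with Fin n.
_hasSize_ : ∀ {a ℓ} → Setoid a ℓ → ℕ → Set (a ⊔ ℓ)
S hasSize n = Inverse (≡.setoid (Fin n)) S

-- Equality ignores the membership proof, so elements are counted once however
-- many proofs of membership they have.
⟦_∣_⟧ : ∀ {a ℓ p} (S : Setoid a ℓ) → Pred (Setoid.Carrier S) p → Setoid (a ⊔ p) ℓ
⟦ S ∣ P ⟧ = On.setoid S (proj₁ {B = P})

record Digraph (a ℓ r : Level) : Set (suc (a ⊔ ℓ ⊔ r)) where
  infix 4 _⟶_
  field
    vertices : Setoid a ℓ
  open Setoid vertices public using (_≈_; _≉_) renaming (Carrier to Vertex)
  field
    _⟶_    : Rel Vertex r
    ⟶-resp : _⟶_ Respects₂ _≈_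

record IsDSRG {a ℓ r : Level} (G : Digraph a ℓ r) (N k t λ′ μ : ℕ) : Set (a ⊔ ℓ ⊔ r) where
  open Digraph G
  field
    order      : vertices hasSize N
    loopless   : ∀ x → ¬ (x ⟶ x)
    out-degree : ∀ x → ⟦ vertices ∣ (λ y → x ⟶ y) ⟧ hasSize k
    in-degree  : ∀ x → ⟦ vertices ∣ (λ y → y ⟶ x) ⟧ hasSize k
    undirected : ∀ x → ⟦ vertices ∣ (λ y → x ⟶ y × y ⟶ x) ⟧ hasSize t
    -- A path of length 2 from x to y is determined by its middle vertex.
    paths-arc  : ∀ x y → x ≉ y → x ⟶ y →
                 ⟦ vertices ∣ (λ z → x ⟶ z × z ⟶ y) ⟧ hasSize λ′
    paths-none : ∀ x y → x ≉ y → ¬ (x ⟶ y) →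
                 ⟦ vertices ∣ (λ z → x ⟶ z × z ⟶ y) ⟧ hasSize μ

record ConnectionSet {c ℓ : Level} (H : Group c ℓ) (p : Level) : Set (c ⊔ ℓ ⊔ suc p) where
  open Group H
  field
    member : Pred Carrier p
    resp   : member Respects _≈_
    ε∉     : ¬ member ε

Cay : ∀ {c ℓ p} (H : Group c ℓ) → ConnectionSet H p → Digraph c ℓ p
Cay H X = record
  { vertices = setoid
  ; _⟶_      = λ x y → member (y ∙ x ⁻¹)
  ; ⟶-resp   = (λ y≈y′ → resp (∙-congʳ y≈y′)) , (λ x≈x′ → resp (∙-congˡ (⁻¹-cong x≈x′)))
  }
  where
  open Group H
  open ConnectionSet X

-- Permutations act on the right, and _∘ₚ_ composes from left to right: the
-- image i^g is g ⟨$⟩ʳ i, and i^(gh) = (i^g)^h holds by definition of g ∘ₚ h.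
-- The product is (g ; k)(g′ ; k′) = (gg′ ; i ↦ k i · k′ (i^g)).
S_≀_ : ∀ {c ℓ} → ℕ → Group c ℓ → Group c ℓ
S_≀_ {c} {ℓ} m K = record
  { Carrier = Permutation′ m × Vector Carrier m
  ; _≈_     = λ (g , k) (g′ , k′) → g Perm.≈ g′ × (∀ i → k i ≈ k′ i)
  ; _∙_     = λ (g , k) (g′ , k′) → g ∘ₚ g′ , λ i → k i ∙ k′ (g ⟨$⟩ʳ i)
  ; ε       = Perm.id , λ _ → ε
  ; _⁻¹     = λ (g , k) → Perm.flip g , λ i → k (g ⟨$⟩ˡ i) ⁻¹
  ; isGroup = record
    { isMonoid = record
      { isSemigroup = record
        { isMagma = record
          { isEquivalence = record
            { refl  = (λ _ → ≡.refl) , (λ _ → refl)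
            ; sym   = λ (p , q) → (λ i → ≡.sym (p i)) , (λ i → sym (q i))
            ; trans = λ (p , q) (p′ , q′) →
                (λ i → ≡.trans (p i) (p′ i)) , (λ i → trans (q i) (q′ i))
            }
          ; ∙-cong = λ {(g , _)} {(g′ , _)} {(h , k)} {(h′ , k′)} (p , q) (p′ , q′) →
              (λ i → ≡.trans (≡.cong (h ⟨$⟩ʳ_) (p i)) (p′ (g′ ⟨$⟩ʳ i))) ,
              (λ i → ∙-cong (q i) (trans (reflexive (≡.cong k (p i))) (q′ (g′ ⟨$⟩ʳ i))))
          }
        ; assoc = λ _ _ _ → (λ _ → ≡.refl) , (λ _ → assoc _ _ _)
        }
      ; identity =
          (λ _ → (λ _ → ≡.refl) , (λ _ → identityˡ _)) ,
          (λ _ → (λ _ → ≡.refl) , (λ _ → identityʳ _))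
      }
    ; inverse =
        (λ (g , _) → (λ _ → Perm.inverseʳ g) , (λ _ → inverseˡ _)) ,
        (λ (g , k) → (λ _ → Perm.inverseˡ g) ,
          (λ i → trans (∙-congˡ (⁻¹-cong (reflexive (≡.cong k (Perm.inverseˡ g)))))
                       (inverseʳ (k i))))
    ; ⁻¹-cong = λ {(g , k)} {(g′ , k′)} (p , q) →
        let p⁻¹ : ∀ i → g ⟨$⟩ˡ i ≡ g′ ⟨$⟩ˡ i
            p⁻¹ i = ≡.trans
              (≡.cong (g ⟨$⟩ˡ_)
                (≡.sym (≡.trans (p (g′ ⟨$⟩ˡ i)) (Perm.inverseʳ g′))))
              (Perm.inverseˡ g)
        in p⁻¹ , (λ i → ⁻¹-cong (trans (reflexive (≡.cong k (p⁻¹ i))) (q (g′ ⟨$⟩ˡ i))))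
    }
  }
  where open Group K

module _ {c ℓ : Level} (K : Group c ℓ) where

  private
    module K = Group K
    module H = Group (S 2 ≀ K)

  ⟨_؛_,_⟩ : Permutation′ 2 → K.Carrier → K.Carrier → H.Carrier
  ⟨ g ؛ k₁ , k₂ ⟩ = g , k₁ ∷ k₂ ∷ []

  π : Permutation′ 2
  π = Perm.transpose 0F 1F

  setA setB setC : Pred H.Carrier (c ⊔ ℓ)
  setA h = ∃ λ u → u K.≉ K.ε × h H.≈ ⟨ Perm.id ؛ u , u ⟩
  setB h = ∃ λ u → u K.≉ K.ε × h H.≈ ⟨ Perm.id ؛ K.ε , u ⟩
  setC h = ∃ λ u → h H.≈ ⟨ π ؛ u , K.ε ⟩

  setD : K.Carrier → Pred H.Carrier (c ⊔ ℓ)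
  setD w h = ∃ λ u → h H.≈ ⟨ π ؛ u , w ⟩

  setY : K.Carrier → ConnectionSet (S 2 ≀ K) (c ⊔ ℓ)
  setY w = record
    { member = setA ∪ setB ∪ setC ∪ setD w
    ; resp   = λ {x} {y} → resp {x} {y}
    ; ε∉     = ε∉
    }
    where
    resp : (setA ∪ setB ∪ setC ∪ setD w) Respects H._≈_
    resp {x} {y} x≈y = λ where
        (inj₁ (u , u≉ε , eq))         → inj₁ (u , u≉ε , move ⟨ Perm.id ؛ u , u ⟩ eq)
        (inj₂ (inj₁ (u , u≉ε , eq)))  → inj₂ (inj₁ (u , u≉ε , move ⟨ Perm.id ؛ K.ε , u ⟩ eq))
        (inj₂ (inj₂ (inj₁ (u , eq)))) → inj₂ (inj₂ (inj₁ (u , move ⟨ π ؛ u , K.ε ⟩ eq)))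
        (inj₂ (inj₂ (inj₂ (u , eq)))) → inj₂ (inj₂ (inj₂ (u , move ⟨ π ؛ u , w ⟩ eq)))
      where
      move : ∀ z → x H.≈ z → y H.≈ z
      move z = H.trans {y} {x} {z} (H.sym {x} {y} x≈y)

    ε∉ : ¬ (setA ∪ setB ∪ setC ∪ setD w) H.ε
    ε∉ (inj₁ (_ , u≉ε , _ , eq))        = u≉ε (K.sym (eq 0F))
    ε∉ (inj₂ (inj₁ (_ , u≉ε , _ , eq))) = u≉ε (K.sym (eq 1F))
    ε∉ (inj₂ (inj₂ (inj₁ (_ , p , _)))) with () ← p 0F
    ε∉ (inj₂ (inj₂ (inj₂ (_ , p , _)))) with () ← p 0F

{-# OPTIONS --safe #-}

-- A path of length 2 in a Cayley digraph from x to y is a pair (a , b) of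
-- elements of Y with b a = h, where h = y x⁻¹; it is determined by a, which
-- ranges over the elements of Y with h a⁻¹ ∈ Y. The case h = ε counts the
-- undirected edges at a vertex. Each of A, B, C, D is parametrized injectively
-- by u ∈ K, so this count splits into four counts of elements u of K. For
-- h = (e;p,q) the sets C and D contribute 2 each; A and B contribute n − 2 and
-- 0 if p = q ≠ e_K, 0 and n − 2 if p = e_K ≠ q, 1 each if p is neither e_K nor
-- q, and n − 1 each if p = q = e_K. For h = (π;p,q) the set A contributes 2, or
-- 1 if q ∈ {e_K , w}; B contributes 0, or n − 1 if q ∈ {e_K , w}; C contributes
-- 2, or 0 if q = e_K; and D contributes 2, or 0 if q = w.
module Submission where

open import Algebra.Bundles using (Group)
import Algebra.Properties.Group as GroupProperties
open import Data.Empty using (⊥-elim)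
open import Data.Fin.Base using (Fin; punchIn; punchOut)
open import Data.Fin.Patterns using (0F; 1F)
open import Data.Fin.Permutation as Perm using (Permutation′; _⟨$⟩ʳ_)
open import Data.Fin.Properties
  using (+↔⊎; *↔×; punchInᵢ≢i; punchIn-punchOut; punchOut-cong; punchOut-punchIn)
open import Data.Nat.Base using (ℕ; zero; suc; _+_; _*_; _∸_; _^_; _>_; s≤s)
open import Data.Nat.Tactic.RingSolver using (solve-∀)
open import Data.Product.Base using (_×_; _,_; ∃; proj₁; proj₂)
open import Data.Product.Function.NonDependent.Setoid using (_×-inverse_)
open import Data.Product.Relation.Binary.Pointwise.NonDependent as × using (_×ₛ_)
open import Data.Sum.Base using (_⊎_; inj₁; inj₂; [_,_]′)
open import Data.Sum.Function.Setoid using (_⊎-inverse_)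
open import Data.Sum.Relation.Binary.Pointwise as ⊎ using (_⊎ₛ_)
open import Data.Unit.Base using (tt)
open import Function.Bundles using (Injection; Inverse)
open import Function.Construct.Composition using (inverse)
open import Function.Construct.Symmetry using () renaming (inverse to sym-inverse)
open import Function.Properties.Inverse using (Inverse⇒Injection)
open import Level using (Level)
open import Relation.Binary.Bundles using (Setoid)
open import Relation.Binary.PropositionalEquality as ≡ using (_≡_)
import Relation.Binary.Reasoning.Setoid as ≈-Reasoning
open import Relation.Nullary.Negation.Core using (¬_)
open import Relation.Unary using (Pred; _∪_; _∩_; U)
open import Defs

-- Counting the elements of setoids and of their subsets.

private
  variable
    a b ℓ ℓ₁ ℓ₂ ℓ₃ ℓ₄ : Level
    m n : ℕ

size-× : {S : Setoid a ℓ₁} {T : Setoid b ℓ₂} →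
  S hasSize m → T hasSize n → (S ×ₛ T) hasSize (m * n)
size-× I J =
  inverse (inverse *↔× (sym-inverse ×.Pointwise-≡↔≡)) (I ×-inverse J)

-- The preimage supplied by `P⇒` may depend on the proof of `P x`; injectivity of `f` makes it
-- unique up to equality, so `from` is well defined. Later counts parametrize a subset by `K`, by
-- pairs from `K`, or by the connection set.
size-image : {S : Setoid a ℓ₁} {T : Setoid b ℓ₂}
  {P : Pred (Setoid.Carrier S) ℓ₃} {Q : Pred (Setoid.Carrier T) ℓ₄} →
  let module S = Setoid S; module T = Setoid T in
  (f : T.Carrier → S.Carrier) →
  (∀ {u v} → u T.≈ v → f u S.≈ f v) →
  (∀ {u v} → f u S.≈ f v → u T.≈ v) →
  (∀ {x} → P x → ∃ λ u → Q u × x S.≈ f u) →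
  (∀ {u} → Q u → P (f u)) →
  ⟦ T ∣ Q ⟧ hasSize n → ⟦ S ∣ P ⟧ hasSize n
size-image {S = S} {T = T} f f-cong f-inj P⇒ ⇐Q I = record
  { to        = λ i → f (proj₁ (I.to i)) , ⇐Q (proj₂ (I.to i))
  ; from      = λ (_ , px) → let (u , qu , _) = P⇒ px in I.from (u , qu)
  ; to-cong   = λ i≡j → f-cong (I.to-cong i≡j)
  ; from-cong = λ {(_ , px)} {(_ , py)} x≈y →
      let (_ , _ , x≈fu) = P⇒ px; (_ , _ , y≈fv) = P⇒ py
      in I.from-cong (f-inj (S.trans (S.sym x≈fu) (S.trans x≈y y≈fv)))
  ; inverse   =
      (λ {(_ , px)} i≡ → let (_ , _ , x≈fu) = P⇒ px
                         in S.trans (f-cong (I.inverseˡ i≡)) (S.sym x≈fu)) ,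
      (λ {_} {(_ , px)} x≈ → let (_ , _ , x≈fu) = P⇒ px
                             in I.inverseʳ (f-inj (S.trans (S.sym x≈fu) x≈)))
  }
  where
  module S = Setoid S
  module T = Setoid T
  module I = Inverse I

module _ {S : Setoid a ℓ} where

  open Setoid S

  size-U : S hasSize n → ⟦ S ∣ U ⟧ hasSize n
  size-U I = record
    { to        = λ i → I.to i , tt
    ; from      = λ (x , _) → I.from x
    ; to-cong   = I.to-cong
    ; from-cong = I.from-cong
    ; inverse   = I.inverseˡ , I.inverseʳ
    }
    where module I = Inverse I

  size-total : {P : Pred Carrier ℓ₃} → (∀ x → P x) → ⟦ S ∣ P ⟧ hasSize n → S hasSize n
  size-total total I = record
    { to        = λ i → proj₁ (I.to i)
    ; from      = λ x → I.from (x , total x)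
    ; to-cong   = I.to-cong
    ; from-cong = I.from-cong
    ; inverse   = I.inverseˡ , I.inverseʳ
    }
    where module I = Inverse I

  module _ {P : Pred Carrier ℓ₃} where

    size-cong : {Q : Pred Carrier ℓ₄} → (∀ {x} → P x → Q x) → (∀ {x} → Q x → P x) →
      ⟦ S ∣ Q ⟧ hasSize n → ⟦ S ∣ P ⟧ hasSize n
    size-cong P⊆Q Q⊆P =
      size-image (λ x → x) (λ e → e) (λ e → e) (λ px → _ , P⊆Q px , refl) Q⊆P

    size-∅ : (∀ {x} → ¬ P x) → ⟦ S ∣ P ⟧ hasSize 0
    size-∅ ∉P = record
      { to        = λ ()
      ; from      = λ (_ , px) → ⊥-elim (∉P px)
      ; to-cong   = λ { {()} }
      ; from-cong = λ {(_ , px)} → ⊥-elim (∉P px)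
      ; inverse   = (λ {(_ , px)} → ⊥-elim (∉P px)) , (λ { {()} })
      }

    size-point : ∀ c → (∀ {x} → P x → x ≈ c) → P c → ⟦ S ∣ P ⟧ hasSize 1
    size-point c P⇒≈c pc = record
      { to        = λ _ → c , pc
      ; from      = λ _ → 0F
      ; to-cong   = λ _ → refl
      ; from-cong = λ _ → ≡.refl
      ; inverse   = (λ {(_ , px)} _ → sym (P⇒≈c px)) , (λ { {0F} _ → ≡.refl })
      }

    -- Skipping the index of `c` with `punchIn` and closing the gap with `punchOut` renumbers the
    -- remaining elements.
    size-remove : ∀ {c} → P c → ⟦ S ∣ P ⟧ hasSize (suc n) → ⟦ S ∣ P ∩ (_≉ c) ⟧ hasSize n
    size-remove {c = c} pc I = record
      { to        = λ j → let (x , px) = I.to (punchIn i j) in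
          x , px , λ x≈c → punchInᵢ≢i i j (≡.sym (I.inverseʳ (sym x≈c)))
      ; from      = λ (x , px , x≉c) → punchOut (i≢ px x≉c)
      ; to-cong   = λ { ≡.refl → refl }
      ; from-cong = λ x≈y → punchOut-cong i (I.from-cong x≈y)
      ; inverse   =
          (λ {(_ , px , x≉c)} → λ { ≡.refl → I.inverseˡ (punchIn-punchOut (i≢ px x≉c)) }) ,
          (λ {j} {(_ , px , x≉c)} x≈ →
            ≡.trans (punchOut-cong i (I.inverseʳ x≈)) (punchOut-punchIn i {j}))
      }
      where
      module I = Inverse I
      i = I.from (c , pc)
      i≢ : ∀ {x} (px : P x) → x ≉ c → ¬ (i ≡ I.from (x , px))
      i≢ px x≉c i≡ = x≉c (trans (sym (I.inverseˡ i≡)) (I.inverseˡ ≡.refl))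

    module _ {Q : Pred Carrier ℓ₄} (disjoint : ∀ {x y} → x ≈ y → P x → ¬ Q y) where

      -- Disjointness is stated for a pair `x ≈ y` because `P` and `Q` are not known to respect `≈`;
      -- it rules out the two mixed cases of `from-cong`.
      size-∪ : ⟦ S ∣ P ⟧ hasSize m → ⟦ S ∣ Q ⟧ hasSize n → ⟦ S ∣ P ∪ Q ⟧ hasSize (m + n)
      size-∪ I J = inverse
        (inverse (inverse +↔⊎ (sym-inverse (⊎.Pointwise-≡↔≡ _ _))) (I ⊎-inverse J))
        merge
        where
        to : (∃ P) ⊎ (∃ Q) → ∃ (P ∪ Q)
        to (inj₁ (x , px)) = x , inj₁ px
        to (inj₂ (x , qx)) = x , inj₂ qx
        from : ∃ (P ∪ Q) → (∃ P) ⊎ (∃ Q)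
        from (x , inj₁ px) = inj₁ (x , px)
        from (x , inj₂ qx) = inj₂ (x , qx)
        module ⊎S = Setoid (⟦ S ∣ P ⟧ ⊎ₛ ⟦ S ∣ Q ⟧)
        to-cong : ∀ {s t} → s ⊎S.≈ t → proj₁ (to s) ≈ proj₁ (to t)
        to-cong (⊎.inj₁ x≈y) = x≈y
        to-cong (⊎.inj₂ x≈y) = x≈y
        from-cong : ∀ s t → proj₁ s ≈ proj₁ t → from s ⊎S.≈ from t
        from-cong (_ , inj₁ _)  (_ , inj₁ _)  x≈y = ⊎.inj₁ x≈y
        from-cong (_ , inj₁ px) (_ , inj₂ qy) x≈y = ⊥-elim (disjoint x≈y px qy)
        from-cong (_ , inj₂ qx) (_ , inj₁ py) x≈y = ⊥-elim (disjoint (sym x≈y) py qx)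
        from-cong (_ , inj₂ _)  (_ , inj₂ _)  x≈y = ⊎.inj₂ x≈y
        to-from : ∀ s → proj₁ (to (from s)) ≈ proj₁ s
        to-from (_ , inj₁ _) = refl
        to-from (_ , inj₂ _) = refl
        from-to : ∀ s → from (to s) ⊎S.≈ s
        from-to (inj₁ _) = ⊎.inj₁ refl
        from-to (inj₂ _) = ⊎.inj₂ refl
        merge : Inverse (⟦ S ∣ P ⟧ ⊎ₛ ⟦ S ∣ Q ⟧) ⟦ S ∣ P ∪ Q ⟧
        merge = record
          { to        = to
          ; from      = from
          ; to-cong   = to-cong
          ; from-cong = λ {s} {t} → from-cong s t
          ; inverse   =
              (λ {s} {t} e → trans (to-cong e) (to-from s)) ,
              (λ {s} {t} e → ⊎S.trans (from-cong t (to s) e) (from-to s))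
          }

  size-pair : {P : Pred Carrier ℓ₃} → ∀ c d → c ≉ d →
    (∀ {x} → P x → x ≈ c ⊎ x ≈ d) → (∀ {x} → x ≈ c → P x) → (∀ {x} → x ≈ d → P x) →
    ⟦ S ∣ P ⟧ hasSize 2
  size-pair c d c≉d P⇒ pc pd = size-cong {Q = (_≈ c) ∪ (_≈ d)} P⇒ [ pc , pd ]′
    (size-∪ (λ x≈y x≈c y≈d → c≉d (trans (sym x≈c) (trans x≈y y≈d)))
      (size-point c (λ e → e) refl) (size-point d (λ e → e) refl))

  size-≉ : ∀ c → S hasSize (suc n) → ⟦ S ∣ (_≉ c) ⟧ hasSize n
  size-≉ c I = size-cong (tt ,_) proj₂ (size-remove tt (size-U I))

  size-≉-≉ : ∀ c d → c ≉ d → S hasSize (suc (suc n)) → ⟦ S ∣ (_≉ c) ∩ (_≉ d) ⟧ hasSize n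
  size-≉-≉ c d c≉d I = size-remove (λ d≈c → c≉d (sym d≈c)) (size-≉ c I)

-- Degrees and paths in the Cayley digraph of an arbitrary group.

module _ {c ℓ p} (G : Group c ℓ) (X : ConnectionSet G p) where

  open Group G
  open GroupProperties G
  open ConnectionSet X
  open Digraph (Cay G X) using (_⟶_)

  private
    //-cancel : ∀ x y z → (x // z) // (y // z) ≈ x // y
    //-cancel x y z = begin
      (x // z) // (y // z)         ≈⟨ ∙-congˡ (⁻¹-anti-homo-// y z) ⟩
      (x // z) ∙ (z // y)          ≈⟨ assoc _ _ _ ⟨
      (x // z) ∙ z ∙ y ⁻¹          ≈⟨ ∙-congʳ (//-rightDividesˡ z x) ⟩
      x // y                       ∎
      where open ≈-Reasoning setoid

    //-∙ : ∀ x y a → y // (a ∙ x) ≈ (y // x) // a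
    //-∙ x y a = begin
      y // (a ∙ x)        ≈⟨ ∙-congˡ (⁻¹-anti-homo-∙ a x) ⟩
      y ∙ (x ⁻¹ ∙ a ⁻¹)   ≈⟨ assoc _ _ _ ⟨
      (y // x) // a       ∎
      where open ≈-Reasoning setoid

  cay-loopless : ∀ x → ¬ (x ⟶ x)
  cay-loopless x x⟶x = ε∉ (resp (inverseʳ x) x⟶x)

  size-out : ∀ x → ⟦ setoid ∣ member ⟧ hasSize n → ⟦ setoid ∣ (λ y → x ⟶ y) ⟧ hasSize n
  size-out x = size-image (_∙ x) ∙-congʳ (∙-cancelʳ x _ _)
    (λ {y} x⟶y → y // x , x⟶y , sym (//-rightDividesˡ x y))
    (λ {a} → resp (sym (//-rightDividesʳ x a)))

  -- The in-neighbours of `x` are the products `a ⁻¹ ∙ x`, because `x // (a ⁻¹ ∙ x)` equals `a`.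
  size-in : ∀ x → ⟦ setoid ∣ member ⟧ hasSize n → ⟦ setoid ∣ (λ y → y ⟶ x) ⟧ hasSize n
  size-in x = size-image (λ a → a ⁻¹ ∙ x) (λ e → ∙-congʳ (⁻¹-cong e))
    (λ e → ⁻¹-injective (∙-cancelʳ x _ _ e))
    (λ {y} y⟶x → x // y , y⟶x ,
      sym (trans (∙-congʳ (⁻¹-anti-homo-// x y)) (//-rightDividesˡ x y)))
    (λ {a} → resp (sym (begin
      x // (a ⁻¹ ∙ x)   ≈⟨ //-∙ x x (a ⁻¹) ⟩
      (x // x) // a ⁻¹  ≈⟨ ∙-cong (inverseʳ x) (⁻¹-involutive a) ⟩
      ε ∙ a             ≈⟨ identityˡ a ⟩
      a                 ∎)))
    where open ≈-Reasoning setoid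

  Middle : Carrier → Pred Carrier p
  Middle h a = member a × member (h // a)

  -- In the wreath product this replaces `h` by a normal form `⟪ g ؛ p , q ⟫` before its coordinates
  -- are analysed.
  size-Middle-resp : ∀ {h h′} → h ≈ h′ →
    ⟦ setoid ∣ Middle h′ ⟧ hasSize n → ⟦ setoid ∣ Middle h ⟧ hasSize n
  size-Middle-resp h≈h′ = size-cong
    (λ (a∈ , ha∈) → a∈ , resp (∙-congʳ h≈h′) ha∈)
    (λ (a∈ , ha∈) → a∈ , resp (∙-congʳ (sym h≈h′)) ha∈)

  -- With the middle vertex written as `a ∙ x`, the first arc is given by `a` and the second by
  -- `y // (a ∙ x)`, which equals `(y // x) // a`.
  size-paths : ∀ x y → ⟦ setoid ∣ Middle (y // x) ⟧ hasSize n →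
    ⟦ setoid ∣ (λ z → x ⟶ z × z ⟶ y) ⟧ hasSize n
  size-paths x y = size-image (_∙ x) ∙-congʳ (∙-cancelʳ x _ _)
    (λ {z} (x⟶z , z⟶y) → z // x , (x⟶z , resp (sym (//-cancel y z x)) z⟶y) ,
      sym (//-rightDividesˡ x z))
    (λ {a} (a∈ , ha∈) → resp (sym (//-rightDividesʳ x a)) a∈ , resp (sym (//-∙ x y a)) ha∈)

-- Permutations of two points and the order of the wreath product.

private
  0≢1 : {A : Set a} → _≡_ {A = Fin 2} 0F 1F → A
  0≢1 ()

-- The images of the two points decide the case; the two patterns with equal images contradict
-- injectivity.
Perm2-cases : (σ : Permutation′ 2) → σ Perm.≈ Perm.id ⊎ σ Perm.≈ Perm.transpose 0F 1F
Perm2-cases σ with σ ⟨$⟩ʳ 0F in eq₀ | σ ⟨$⟩ʳ 1F in eq₁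
... | 0F | 1F = inj₁ λ { 0F → eq₀ ; 1F → eq₁ }
... | 1F | 0F = inj₂ λ { 0F → eq₀ ; 1F → eq₁ }
... | 0F | 0F = 0≢1 (Injection.injective (Inverse⇒Injection σ) (≡.trans eq₀ (≡.sym eq₁)))
... | 1F | 1F = 0≢1 (Injection.injective (Inverse⇒Injection σ) (≡.trans eq₀ (≡.sym eq₁)))

module _ {c ℓ} (K : Group c ℓ) where

  private
    module K = Group K
    module H = Group (S 2 ≀ K)
    H = S 2 ≀ K
    e = Perm.id {2}
    τ = π K

    ⟪_؛_,_⟫ : Permutation′ 2 → K.Carrier → K.Carrier → H.Carrier
    ⟪_؛_,_⟫ = ⟨_؛_,_⟩ K

  open K using (_≈_; _≉_; ε; _∙_; _//_; _\\_)
  open GroupProperties K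

  ⟪⟫-cong : ∀ g {r r′ s s′} → r ≈ r′ → s ≈ s′ → ⟪ g ؛ r , s ⟫ H.≈ ⟪ g ؛ r′ , s′ ⟫
  ⟪⟫-cong _ r≈ s≈ = (λ _ → ≡.refl) , λ { 0F → r≈ ; 1F → s≈ }

  ≈⟪⟫ : ∀ g (h : H.Carrier) → proj₁ h Perm.≈ g → h H.≈ ⟪ g ؛ proj₂ h 0F , proj₂ h 1F ⟫
  ≈⟪⟫ _ h h≈ = h≈ , λ { 0F → K.refl ; 1F → K.refl }

  size-≀ : K.setoid hasSize n → H.setoid hasSize (2 * n ^ 2)
  size-≀ {n} I = ≡.subst (H.setoid hasSize_) (2n² n)
    (size-total {P = (λ h → proj₁ h Perm.≈ e) ∪ (λ h → proj₁ h Perm.≈ τ)}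
      (λ h → Perm2-cases (proj₁ h))
      (size-∪ (λ { (x≈y , _) x≈ y≈ → 0≢1 (≡.trans (≡.sym (x≈ 0F)) (≡.trans (x≈y 0F) (y≈ 0F))) })
        (part e) (part τ)))
    where
    -- The right-hand side is `2 * n ^ 2` with the power unfolded.
    2n² : ∀ n → n * n + n * n ≡ 2 * (n * (n * 1))
    2n² = solve-∀
    part : ∀ g → ⟦ H.setoid ∣ (λ h → proj₁ h Perm.≈ g) ⟧ hasSize (n * n)
    part g = size-image (λ (r , s) → ⟪ g ؛ r , s ⟫) (λ (r≈ , s≈) → ⟪⟫-cong g r≈ s≈)
      (λ (_ , eq) → eq 0F , eq 1F)
      (λ {h} h≈ → _ , tt , ≈⟪⟫ g h h≈) (λ _ _ → ≡.refl)
      (size-U (size-× I I))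

  -- Membership in Y, and its solution for the parameter in K.

  module _ (w : K.Carrier) (w≉ε : w ≉ ε) where

    open ConnectionSet (setY K w)

    -- The first alternative places (e;p,q) in A, the second in B.
    Y-id : K.Carrier → K.Carrier → Set ℓ
    Y-id p q = p ≉ ε × q ≈ p ⊎ p ≈ ε × q ≉ ε

    -- Whether (π;p,q) lies in C or D depends on its second coordinate alone, since the first runs
    -- over all of K.
    Y-π : K.Carrier → Set ℓ
    Y-π q = q ≈ ε ⊎ q ≈ w

    -- The permutation is compared pointwise so that the lemma applies to quotients `h H.// a`,
    -- whose permutation is a composite with a flip.
    member-id : ∀ (h : H.Carrier) → proj₁ h Perm.≈ e →
      member h → Y-id (proj₂ h 0F) (proj₂ h 1F)
    member-id h h≈ (inj₁ (u , u≉ε , _ , eq)) =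
      inj₁ ((λ h₀≈ε → u≉ε (K.trans (K.sym (eq 0F)) h₀≈ε)) , K.trans (eq 1F) (K.sym (eq 0F)))
    member-id h h≈ (inj₂ (inj₁ (u , u≉ε , _ , eq))) =
      inj₂ (eq 0F , λ h₁≈ε → u≉ε (K.trans (K.sym (eq 1F)) h₁≈ε))
    member-id h h≈ (inj₂ (inj₂ (inj₁ (_ , g≈ , _)))) = 0≢1 (≡.trans (≡.sym (h≈ 0F)) (g≈ 0F))
    member-id h h≈ (inj₂ (inj₂ (inj₂ (_ , g≈ , _)))) = 0≢1 (≡.trans (≡.sym (h≈ 0F)) (g≈ 0F))

    id-member : ∀ (h : H.Carrier) → proj₁ h Perm.≈ e →
      Y-id (proj₂ h 0F) (proj₂ h 1F) → member h
    id-member h h≈ (inj₁ (p≉ε , q≈p)) = inj₁ (_ , p≉ε , h≈ , λ { 0F → K.refl ; 1F → q≈p })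
    id-member h h≈ (inj₂ (p≈ε , q≉ε)) = inj₂ (inj₁ (_ , q≉ε , h≈ , λ { 0F → p≈ε ; 1F → K.refl }))

    member-π : ∀ (h : H.Carrier) → proj₁ h Perm.≈ τ → member h → Y-π (proj₂ h 1F)
    member-π h h≈ (inj₁ (_ , _ , g≈ , _))        = 0≢1 (≡.trans (≡.sym (g≈ 0F)) (h≈ 0F))
    member-π h h≈ (inj₂ (inj₁ (_ , _ , g≈ , _))) = 0≢1 (≡.trans (≡.sym (g≈ 0F)) (h≈ 0F))
    member-π h h≈ (inj₂ (inj₂ (inj₁ (_ , _ , eq)))) = inj₁ (eq 1F)
    member-π h h≈ (inj₂ (inj₂ (inj₂ (_ , _ , eq)))) = inj₂ (eq 1F)

    π-member : ∀ (h : H.Carrier) → proj₁ h Perm.≈ τ → Y-π (proj₂ h 1F) → member h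
    π-member h h≈ (inj₁ q≈ε) = inj₂ (inj₂ (inj₁ (_ , h≈ , λ { 0F → K.refl ; 1F → q≈ε })))
    π-member h h≈ (inj₂ q≈w) = inj₂ (inj₂ (inj₂ (_ , h≈ , λ { 0F → K.refl ; 1F → q≈w })))

    -- The four sets are disjoint: the permutation separates A and B from C and D, the first
    -- coordinate separates A from B, and the second separates C from D because `w ≉ ε`. Taking `R`
    -- to be membership of `h H.// a` turns the intersection into `Middle h`.
    size-Y∩ : ∀ {r n₁ n₂ n₃ n₄} {R : Pred H.Carrier r} → (∀ {x y} → x H.≈ y → R x → R y) →
      ⟦ K.setoid ∣ (λ u → u ≉ ε × R ⟪ e ؛ u , u ⟫) ⟧ hasSize n₁ →
      ⟦ K.setoid ∣ (λ u → u ≉ ε × R ⟪ e ؛ ε , u ⟫) ⟧ hasSize n₂ →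
      ⟦ K.setoid ∣ (λ u → R ⟪ τ ؛ u , ε ⟫) ⟧ hasSize n₃ →
      ⟦ K.setoid ∣ (λ u → R ⟪ τ ؛ u , w ⟫) ⟧ hasSize n₄ →
      ⟦ H.setoid ∣ member ∩ R ⟧ hasSize (n₁ + (n₂ + (n₃ + n₄)))
    size-Y∩ {R = R} R-resp I₁ I₂ I₃ I₄ =
      size-cong {Q = setA K ∩ R ∪ (setB K ∩ R ∪ (setC K ∩ R ∪ setD K w ∩ R))}
        (λ { (inj₁ a , r) → inj₁ (a , r)
           ; (inj₂ (inj₁ b) , r) → inj₂ (inj₁ (b , r))
           ; (inj₂ (inj₂ (inj₁ c)) , r) → inj₂ (inj₂ (inj₁ (c , r)))
           ; (inj₂ (inj₂ (inj₂ d)) , r) → inj₂ (inj₂ (inj₂ (d , r))) })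
        (λ { (inj₁ (a , r)) → inj₁ a , r
           ; (inj₂ (inj₁ (b , r))) → inj₂ (inj₁ b) , r
           ; (inj₂ (inj₂ (inj₁ (c , r)))) → inj₂ (inj₂ (inj₁ c)) , r
           ; (inj₂ (inj₂ (inj₂ (d , r)))) → inj₂ (inj₂ (inj₂ d)) , r })
        (size-∪ A-disjoint
          (size-image (λ u → ⟪ e ؛ u , u ⟫) (λ u≈ → ⟪⟫-cong e u≈ u≈) (λ (_ , eq) → eq 0F)
            (λ { ((u , u≉ε , h≈) , r) → u , (u≉ε , R-resp h≈ r) , h≈ })
            (λ { {u} (u≉ε , r) → (u , u≉ε , H.refl {⟪ e ؛ u , u ⟫}) , r }) I₁)
        (size-∪ B-disjoint
          (size-image (λ u → ⟪ e ؛ ε , u ⟫) (⟪⟫-cong e K.refl) (λ (_ , eq) → eq 1F)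
            (λ { ((u , u≉ε , h≈) , r) → u , (u≉ε , R-resp h≈ r) , h≈ })
            (λ { {u} (u≉ε , r) → (u , u≉ε , H.refl {⟪ e ؛ ε , u ⟫}) , r }) I₂)
        (size-∪ C-disjoint
          (size-image (λ u → ⟪ τ ؛ u , ε ⟫) (λ u≈ → ⟪⟫-cong τ u≈ K.refl) (λ (_ , eq) → eq 0F)
            (λ { ((u , h≈) , r) → u , R-resp h≈ r , h≈ })
            (λ { {u} r → (u , H.refl {⟪ τ ؛ u , ε ⟫}) , r }) I₃)
          (size-image (λ u → ⟪ τ ؛ u , w ⟫) (λ u≈ → ⟪⟫-cong τ u≈ K.refl) (λ (_ , eq) → eq 0F)
            (λ { ((u , h≈) , r) → u , R-resp h≈ r , h≈ })
            (λ { {u} r → (u , H.refl {⟪ τ ؛ u , w ⟫}) , r }) I₄))))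
      where
      e≢τ : ∀ {a} {A : Set a} {x y : H.Carrier} →
        x H.≈ y → proj₁ x Perm.≈ e → proj₁ y Perm.≈ τ → A
      e≢τ (x≈y , _) x≈ y≈ = 0≢1 (≡.trans (≡.sym (x≈ 0F)) (≡.trans (x≈y 0F) (y≈ 0F)))
      A-disjoint : ∀ {x y} → x H.≈ y → (setA K ∩ R) x →
        ¬ (setB K ∩ R ∪ (setC K ∩ R ∪ setD K w ∩ R)) y
      A-disjoint (_ , x≈y) ((u , u≉ε , _ , x≈) , _) (inj₁ ((_ , _ , _ , y≈) , _)) =
        u≉ε (K.trans (K.sym (x≈ 0F)) (K.trans (x≈y 0F) (y≈ 0F)))
      A-disjoint {x} {y} x≈y ((_ , _ , x≈ , _) , _) (inj₂ (inj₁ ((_ , y≈ , _) , _))) =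
        e≢τ {x = x} {y} x≈y x≈ y≈
      A-disjoint {x} {y} x≈y ((_ , _ , x≈ , _) , _) (inj₂ (inj₂ ((_ , y≈ , _) , _))) =
        e≢τ {x = x} {y} x≈y x≈ y≈
      B-disjoint : ∀ {x y} → x H.≈ y → (setB K ∩ R) x → ¬ (setC K ∩ R ∪ setD K w ∩ R) y
      B-disjoint {x} {y} x≈y ((_ , _ , x≈ , _) , _) (inj₁ ((_ , y≈ , _) , _)) =
        e≢τ {x = x} {y} x≈y x≈ y≈
      B-disjoint {x} {y} x≈y ((_ , _ , x≈ , _) , _) (inj₂ ((_ , y≈ , _) , _)) =
        e≢τ {x = x} {y} x≈y x≈ y≈
      C-disjoint : ∀ {x y} → x H.≈ y → (setC K ∩ R) x → ¬ (setD K w ∩ R) y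
      C-disjoint (_ , x≈y) ((_ , _ , x≈) , _) ((_ , _ , y≈) , _) =
        w≉ε (K.trans (K.sym (y≈ 1F)) (K.trans (K.sym (x≈y 1F)) (x≈ 1F)))

    //≈⇒≈\\ : ∀ {q u r} → q // u ≈ r → u ≈ r \\ q
    //≈⇒≈\\ {q} {u} {r} q//u≈r = begin
      u                    ≈⟨ \\-leftDividesʳ r u ⟨
      r \\ (r ∙ u)         ≈⟨ \\-cong₂ K.refl (K.∙-congʳ q//u≈r) ⟨
      r \\ ((q // u) ∙ u)  ≈⟨ \\-cong₂ K.refl (//-rightDividesˡ u q) ⟩
      r \\ q               ∎
      where open ≈-Reasoning K.setoid

    ≈\\⇒//≈ : ∀ {q u r} → u ≈ r \\ q → q // u ≈ r
    ≈\\⇒//≈ {q} {u} {r} u≈r\\q = begin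
      q // u                ≈⟨ //-cong₂ (\\-leftDividesˡ r q) K.refl ⟨
      (r ∙ (r \\ q)) // u   ≈⟨ //-cong₂ (K.∙-congˡ u≈r\\q) K.refl ⟨
      (r ∙ u) // u          ≈⟨ //-rightDividesʳ u r ⟩
      r                     ∎
      where open ≈-Reasoning K.setoid

    //ε : ∀ q → q // ε ≈ q
    //ε q = K.trans (K.∙-congˡ ε⁻¹≈ε) (K.identityʳ q)

    \\≈ε⇒≈ : ∀ {p q} → p \\ q ≈ ε → q ≈ p
    \\≈ε⇒≈ {p} {q} eq =
      K.trans (K.sym (\\-leftDividesˡ p q)) (K.trans (K.∙-congˡ eq) (K.identityʳ p))

    -- This is membership of (e; p u⁻¹, q v⁻¹) in A or B, with the comparisons to the identity
    -- cleared of inverses, ready to be solved for `u`.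
    Y-id-// : (p u q v : K.Carrier) → Set ℓ
    Y-id-// p u q v = p ≉ u × q // v ≈ p // u ⊎ p ≈ u × q ≉ v

    Y-id⇒// : ∀ {p u q v} → Y-id (p // u) (q // v) → Y-id-// p u q v
    Y-id⇒// (inj₁ (p//u≉ε , eq)) = inj₁ ((λ p≈u → p//u≉ε (x≈y⇒x∙y⁻¹≈ε p≈u)) , eq)
    Y-id⇒// (inj₂ (p//u≈ε , q//v≉ε)) =
      inj₂ (x∙y⁻¹≈ε⇒x≈y _ _ p//u≈ε , λ q≈v → q//v≉ε (x≈y⇒x∙y⁻¹≈ε q≈v))

    //⇒Y-id : ∀ {p u q v} → Y-id-// p u q v → Y-id (p // u) (q // v)
    //⇒Y-id (inj₁ (p≉u , eq)) = inj₁ ((λ eq → p≉u (x∙y⁻¹≈ε⇒x≈y _ _ eq)) , eq)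
    //⇒Y-id (inj₂ (p≈u , q≉v)) =
      inj₂ (x≈y⇒x∙y⁻¹≈ε p≈u , λ eq → q≉v (x∙y⁻¹≈ε⇒x≈y _ _ eq))

    Y-π⇒≈ : ∀ {q u} → Y-π (q // u) → u ≈ q ⊎ u ≈ w \\ q
    Y-π⇒≈ (inj₁ q//u≈ε) = inj₁ (K.sym (x∙y⁻¹≈ε⇒x≈y _ _ q//u≈ε))
    Y-π⇒≈ (inj₂ q//u≈w) = inj₂ (//≈⇒≈\\ q//u≈w)

    ≈⇒Y-π : ∀ {q u} → u ≈ q → Y-π (q // u)
    ≈⇒Y-π u≈q = inj₁ (x≈y⇒x∙y⁻¹≈ε (K.sym u≈q))

    ≈\\⇒Y-π : ∀ {q u} → u ≈ w \\ q → Y-π (q // u)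
    ≈\\⇒Y-π u≈w\\q = inj₂ (≈\\⇒//≈ u≈w\\q)

    ≉w\\ : ∀ q → q ≉ w \\ q
    ≉w\\ q q≈w\\q = w≉ε (K.trans (K.sym (≈\\⇒//≈ q≈w\\q)) (K.inverseʳ q))

    -- The two solutions are u = q and u = w⁻¹ q; they differ because `w ≉ ε`.
    size-Y-π-// : ∀ q → ⟦ K.setoid ∣ (λ u → Y-π (q // u)) ⟧ hasSize 2
    size-Y-π-// q = size-pair q (w \\ q) (≉w\\ q) Y-π⇒≈ ≈⇒Y-π ≈\\⇒Y-π

    -- Each alternative has one solution: u = (q v⁻¹)⁻¹ p for A and u = p for B. They differ because
    -- q v⁻¹ is not the identity.
    size-Y-id-// : ∀ p q v → q ≉ v → ⟦ K.setoid ∣ (λ u → Y-id-// p u q v) ⟧ hasSize 2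
    size-Y-id-// p q v q≉v = size-pair p r p≉r
      (λ { (inj₁ (_ , eq)) → inj₂ (//≈⇒≈\\ (K.sym eq))
         ; (inj₂ (p≈u , _)) → inj₁ (K.sym p≈u) })
      (λ u≈p → inj₂ (K.sym u≈p , q≉v))
      (λ u≈r → inj₁ ((λ p≈u → p≉r (K.trans p≈u u≈r)) , K.sym (≈\\⇒//≈ u≈r)))
      where
      r = (q // v) \\ p
      p≉r : p ≉ r
      p≉r p≈r = q≉v (x∙y⁻¹≈ε⇒x≈y _ _ (K.trans (K.sym (≈\\⇒//≈ p≈r)) (K.inverseʳ p)))

    size-Y-id-//-∅ : ∀ p v → ⟦ K.setoid ∣ (λ u → Y-id-// p u v v) ⟧ hasSize 0
    size-Y-id-//-∅ p v = size-∅ λ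
      { (inj₁ (p≉u , eq)) → p≉u (x∙y⁻¹≈ε⇒x≈y _ _ (K.trans (K.sym eq) (K.inverseʳ v)))
      ; (inj₂ (_ , v≉v)) → v≉v K.refl }

    -- Middle vertices in terms of the coordinates of h.

    private
      Mid : H.Carrier → Pred H.Carrier _
      Mid = Middle H (setY K w)

      //-resp : ∀ h {x y} → x H.≈ y → member (h H.// x) → member (h H.// y)
      //-resp h {x} {y} x≈y = resp {h H.// x} {h H.// y}
        (H.∙-congˡ {h} {x H.⁻¹} {y H.⁻¹} (H.⁻¹-cong {x} {y} x≈y))

    -- Dividing by an element of A or B keeps the coordinates in place. Dividing by (π;u,v) crosses
    -- them, so the second coordinate of the quotient is q u⁻¹ for C and D alike, whence the two
    -- constants 2.
    size-Middle-id : ∀ p q {n₁ n₂} →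
      ⟦ K.setoid ∣ (λ u → u ≉ ε × Y-id-// p u q u) ⟧ hasSize n₁ →
      ⟦ K.setoid ∣ (λ u → u ≉ ε × Y-id-// p ε q u) ⟧ hasSize n₂ →
      ⟦ H.setoid ∣ Mid ⟪ e ؛ p , q ⟫ ⟧ hasSize (n₁ + (n₂ + (2 + 2)))
    size-Middle-id p q I J = size-Y∩ (λ {x} {y} → //-resp h {x} {y})
      (size-cong (λ {u} (u≉ε , y) → u≉ε , Y-id⇒// (member-id (h H.// ⟪ e ؛ u , u ⟫) e≈ y))
                 (λ {u} (u≉ε , y) → u≉ε , id-member (h H.// ⟪ e ؛ u , u ⟫) e≈ (//⇒Y-id y)) I)
      (size-cong (λ {u} (u≉ε , y) → u≉ε , Y-id⇒// (member-id (h H.// ⟪ e ؛ ε , u ⟫) e≈ y))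
                 (λ {u} (u≉ε , y) → u≉ε , id-member (h H.// ⟪ e ؛ ε , u ⟫) e≈ (//⇒Y-id y)) J)
      (size-cong (λ {u} → member-π (h H.// ⟪ τ ؛ u , ε ⟫) τ≈)
                 (λ {u} → π-member (h H.// ⟪ τ ؛ u , ε ⟫) τ≈) (size-Y-π-// q))
      (size-cong (λ {u} → member-π (h H.// ⟪ τ ؛ u , w ⟫) τ≈)
                 (λ {u} → π-member (h H.// ⟪ τ ؛ u , w ⟫) τ≈) (size-Y-π-// q))
      where
      h = ⟪ e ؛ p , q ⟫
      e≈ : e Perm.∘ₚ Perm.flip e Perm.≈ e
      e≈ _ = ≡.refl
      τ≈ : e Perm.∘ₚ Perm.flip τ Perm.≈ τ
      τ≈ = λ { 0F → ≡.refl ; 1F → ≡.refl }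

    -- Here the quotients by A and B are the crossed ones: the second coordinate is q u⁻¹ for A, and
    -- q ε⁻¹ for B, where it no longer depends on `u`. For C and D the coordinates stay in place,
    -- with v equal to ε or w.
    size-Middle-π : ∀ p q {n₁ n₂ n₃ n₄} →
      ⟦ K.setoid ∣ (λ u → u ≉ ε × Y-π (q // u)) ⟧ hasSize n₁ →
      ⟦ K.setoid ∣ (λ u → u ≉ ε × Y-π (q // ε)) ⟧ hasSize n₂ →
      ⟦ K.setoid ∣ (λ u → Y-id-// p u q ε) ⟧ hasSize n₃ →
      ⟦ K.setoid ∣ (λ u → Y-id-// p u q w) ⟧ hasSize n₄ →
      ⟦ H.setoid ∣ Mid ⟪ τ ؛ p , q ⟫ ⟧ hasSize (n₁ + (n₂ + (n₃ + n₄)))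
    size-Middle-π p q I₁ I₂ I₃ I₄ = size-Y∩ (λ {x} {y} → //-resp h {x} {y})
      (size-cong (λ {u} (u≉ε , y) → u≉ε , member-π (h H.// ⟪ e ؛ u , u ⟫) τ≈ y)
                 (λ {u} (u≉ε , y) → u≉ε , π-member (h H.// ⟪ e ؛ u , u ⟫) τ≈ y) I₁)
      (size-cong (λ {u} (u≉ε , y) → u≉ε , member-π (h H.// ⟪ e ؛ ε , u ⟫) τ≈ y)
                 (λ {u} (u≉ε , y) → u≉ε , π-member (h H.// ⟪ e ؛ ε , u ⟫) τ≈ y) I₂)
      (size-cong (λ {u} y → Y-id⇒// (member-id (h H.// ⟪ τ ؛ u , ε ⟫) e≈ y))
                 (λ {u} y → id-member (h H.// ⟪ τ ؛ u , ε ⟫) e≈ (//⇒Y-id y)) I₃)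
      (size-cong (λ {u} y → Y-id⇒// (member-id (h H.// ⟪ τ ؛ u , w ⟫) e≈ y))
                 (λ {u} y → id-member (h H.// ⟪ τ ؛ u , w ⟫) e≈ (//⇒Y-id y)) I₄)
      where
      h = ⟪ τ ؛ p , q ⟫
      τ≈ : τ Perm.∘ₚ Perm.flip e Perm.≈ τ
      τ≈ _ = ≡.refl
      e≈ : τ Perm.∘ₚ Perm.flip τ Perm.≈ e
      e≈ = λ { 0F → ≡.refl ; 1F → ≡.refl }

    size-Middle-∉ : ∀ h → ¬ (h H.≈ H.ε) → ¬ member h → ⟦ H.setoid ∣ Mid h ⟧ hasSize 6
    size-Middle-∉ h h≉ε h∉Y with Perm2-cases (proj₁ h)
    ... | inj₁ h≈e = size-Middle-resp H (setY K w) {h = h} {h′ = ⟪ e ؛ p , q ⟫} (≈⟪⟫ e h h≈e)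
      (size-Middle-id p q
        -- As `q ≉ p`, the quotient (e; p u⁻¹, q u⁻¹) cannot lie in A, and it lies in B exactly when
        -- u = p.
        (size-point p
          (λ { (_ , inj₁ (_ , eq)) → ⊥-elim (q≉p (∙-cancelʳ _ _ _ eq))
             ; (_ , inj₂ (p≈u , _)) → K.sym p≈u })
          (p≉ε , inj₂ (K.refl , q≉p)))
        -- As `p ≉ ε`, the quotient (e; p, q u⁻¹) can lie only in A. This forces u = p⁻¹ q, which is
        -- not the identity because `q ≉ p`.
        (size-point (p \\ q)
          (λ { (_ , inj₁ (_ , eq)) → //≈⇒≈\\ (K.trans eq (//ε p))
             ; (_ , inj₂ (p≈ε , _)) → ⊥-elim (p≉ε p≈ε) })
          ((λ eq → q≉p (\\≈ε⇒≈ eq)) ,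
           inj₁ (p≉ε , K.trans (≈\\⇒//≈ K.refl) (K.sym (//ε p))))))
      where
      p = proj₂ h 0F
      q = proj₂ h 1F
      p≉ε : p ≉ ε
      -- If p were the identity, h would lie in B, or would itself be the identity when q is too.
      p≉ε p≈ε = h∉Y (id-member h h≈e (inj₂ (p≈ε , λ q≈ε →
        h≉ε (h≈e , λ { 0F → p≈ε ; 1F → q≈ε }))))
      q≉p : q ≉ p
      q≉p q≈p = h∉Y (id-member h h≈e (inj₁ (p≉ε , q≈p)))
    ... | inj₂ h≈τ = size-Middle-resp H (setY K w) {h = h} {h′ = ⟪ τ ؛ p , q ⟫} (≈⟪⟫ τ h h≈τ)
      (size-Middle-π p q
        -- The condition `u ≉ ε` removes neither solution: `q ≉ ε` keeps the first and `q ≉ w` keeps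
        -- the second.
        (size-pair q (w \\ q) (≉w\\ q) (λ (_ , y) → Y-π⇒≈ y)
          (λ u≈q → (λ u≈ε → q≉ε (K.trans (K.sym u≈q) u≈ε)) , ≈⇒Y-π u≈q)
          (λ u≈ → (λ u≈ε → q≉w (\\≈ε⇒≈ (K.trans (K.sym u≈) u≈ε))) , ≈\\⇒Y-π u≈))
        (size-∅ λ { (_ , inj₁ eq) → q≉ε (K.trans (K.sym (//ε q)) eq)
                  ; (_ , inj₂ eq) → q≉w (K.trans (K.sym (//ε q)) eq) })
        (size-Y-id-// p q ε q≉ε)
        (size-Y-id-// p q w q≉w))
      where
      p = proj₂ h 0F
      q = proj₂ h 1F
      q≉ε : q ≉ ε
      q≉ε q≈ε = h∉Y (π-member h h≈τ (inj₁ q≈ε))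
      q≉w : q ≉ w
      q≉w q≈w = h∉Y (π-member h h≈τ (inj₂ q≈w))

    -- Counts that depend on the order n = 2 + m of K.

    module _ {m} (I : K.setoid hasSize (2 + m)) where

      size-Y : ⟦ H.setoid ∣ member ⟧ hasSize (4 * (2 + m) ∸ 2)
      size-Y = ≡.subst (⟦ H.setoid ∣ member ⟧ hasSize_) (count m)
        (size-cong {Q = member ∩ U} (_, tt) proj₁
          (size-Y∩ (λ _ _ → tt) non-ε non-ε (size-U I) (size-U I)))
        where
        non-ε : ⟦ K.setoid ∣ (λ u → u ≉ ε × U u) ⟧ hasSize (1 + m)
        non-ε = size-cong proj₁ (_, tt) (size-≉ ε I)
        -- The right-hand side is 4 * (2 + m) ∸ 2, reduced because the solver does not know ∸.
        count : ∀ m → 1 + m + (1 + m + (2 + m + (2 + m)))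
          ≡ m + (2 + m + (2 + m + (2 + m + 0)))
        count = solve-∀

      -- A and B are closed under inversion, so all of their 2(n - 1) elements count, together with
      -- two elements from each of C and D.
      size-Middle-ε : ⟦ H.setoid ∣ Mid H.ε ⟧ hasSize (2 * (2 + m) + 2)
      size-Middle-ε = ≡.subst (⟦ H.setoid ∣ Mid H.ε ⟧ hasSize_) (count m)
        (size-Middle-resp H (setY K w) {h = H.ε} {h′ = ⟪ e ؛ ε , ε ⟫}
          (≈⟪⟫ e H.ε (λ _ → ≡.refl))
          (size-Middle-id ε ε
            (size-cong proj₁ (λ u≉ε → u≉ε , inj₁ ((λ ε≈u → u≉ε (K.sym ε≈u)) , K.refl))
              (size-≉ ε I))
            (size-cong proj₁ (λ u≉ε → u≉ε , inj₂ (K.refl , (λ ε≈u → u≉ε (K.sym ε≈u))))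
              (size-≉ ε I))))
        where
        count : ∀ m → 1 + m + (1 + m + 4) ≡ 2 * (2 + m) + 2
        count = solve-∀

      -- The total n + 2 arises differently for h in A, B, C and D: as (n - 2) + 0 + 4, 0 + (n - 2)
      -- + 4, 1 + (n - 1) + 0 + 2 and 1 + (n - 1) + 2 + 0.
      size-Middle-∈ : ∀ h → member h → ⟦ H.setoid ∣ Mid h ⟧ hasSize (2 + m + 2)
      size-Middle-∈ h (inj₁ (p , p≉ε , h≈)) =
        ≡.subst (⟦ H.setoid ∣ Mid h ⟧ hasSize_) (count m)
        (size-Middle-resp H (setY K w) {h = h} {h′ = ⟪ e ؛ p , p ⟫} h≈
          (size-Middle-id p p
            (size-cong
              (λ { (u≉ε , inj₁ (p≉u , _)) → u≉ε , λ u≈p → p≉u (K.sym u≈p)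
                 ; (_ , inj₂ (p≈u , p≉u)) → ⊥-elim (p≉u p≈u) })
              (λ (u≉ε , u≉p) → u≉ε , inj₁ ((λ p≈u → u≉p (K.sym p≈u)) , K.refl))
              (size-≉-≉ ε p (λ ε≈p → p≉ε (K.sym ε≈p)) I))
            (size-∅
              (λ { (u≉ε , inj₁ (_ , eq)) → u≉ε (⁻¹-injective (∙-cancelˡ _ _ _ eq))
                 ; (_ , inj₂ (p≈ε , _)) → p≉ε p≈ε }))))
        where
        count : ∀ m → m + (0 + 4) ≡ 2 + m + 2
        count = solve-∀
      size-Middle-∈ h (inj₂ (inj₁ (q , q≉ε , h≈))) =
        ≡.subst (⟦ H.setoid ∣ Mid h ⟧ hasSize_) (count m)
        (size-Middle-resp H (setY K w) {h = h} {h′ = ⟪ e ؛ ε , q ⟫} h≈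
          (size-Middle-id ε q
            (size-∅
              (λ { (_ , inj₁ (_ , eq)) → q≉ε (∙-cancelʳ _ _ _ eq)
                 ; (u≉ε , inj₂ (ε≈u , _)) → u≉ε (K.sym ε≈u) }))
            (size-cong
              (λ { (_ , inj₁ (ε≉ε , _)) → ⊥-elim (ε≉ε K.refl)
                 ; (u≉ε , inj₂ (_ , q≉u)) → u≉ε , λ u≈q → q≉u (K.sym u≈q) })
              (λ (u≉ε , u≉q) → u≉ε , inj₂ (K.refl , λ q≈u → u≉q (K.sym q≈u)))
              (size-≉-≉ ε q (λ ε≈q → q≉ε (K.sym ε≈q)) I))))
        where
        count : ∀ m → 0 + (m + 4) ≡ 2 + m + 2
        count = solve-∀
      size-Middle-∈ h (inj₂ (inj₂ (inj₁ (p , h≈)))) =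
        ≡.subst (⟦ H.setoid ∣ Mid h ⟧ hasSize_) (count m)
        (size-Middle-resp H (setY K w) {h = h} {h′ = ⟪ τ ؛ p , ε ⟫} h≈
          (size-Middle-π p ε
            -- Of the two solutions ε and w⁻¹ the first is excluded by `u ≉ ε`.
            (size-point (w \\ ε)
              (λ (u≉ε , y) → [ (λ u≈ε → ⊥-elim (u≉ε u≈ε)) , (λ u≈ → u≈) ]′ (Y-π⇒≈ y))
              ((λ eq → w≉ε (K.sym (\\≈ε⇒≈ eq))) , ≈\\⇒Y-π K.refl))
            -- The crossed second coordinate is the identity for every `u`, so all of B counts.
            (size-cong proj₁ (_, inj₁ (//ε ε)) (size-≉ ε I))
            (size-Y-id-//-∅ p ε)
            (size-Y-id-// p ε w (λ ε≈w → w≉ε (K.sym ε≈w)))))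
        where
        count : ∀ m → 1 + (1 + m + (0 + 2)) ≡ 2 + m + 2
        count = solve-∀
      size-Middle-∈ h (inj₂ (inj₂ (inj₂ (p , h≈)))) =
        ≡.subst (⟦ H.setoid ∣ Mid h ⟧ hasSize_) (count m)
        (size-Middle-resp H (setY K w) {h = h} {h′ = ⟪ τ ؛ p , w ⟫} h≈
          (size-Middle-π p w
            -- The solutions are w and w⁻¹ w; the latter is the identity and is excluded.
            (size-point w
              (λ (u≉ε , y) → [ (λ u≈w → u≈w) ,
                (λ u≈ → ⊥-elim (u≉ε (K.trans u≈ (K.inverseˡ w)))) ]′ (Y-π⇒≈ y))
              (w≉ε , ≈⇒Y-π K.refl))
            (size-cong proj₁ (_, inj₂ (//ε w)) (size-≉ ε I))
            (size-Y-id-// p w ε w≉ε)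
            (size-Y-id-//-∅ p w)))
        where
        count : ∀ m → 1 + (1 + m + (2 + 0)) ≡ 2 + m + 2
        count = solve-∀

theorem3p3 : ∀ {c ℓ} (n : ℕ) → n > 2 →
    (K : Group c ℓ) → Group.setoid K hasSize n →
    (w : Group.Carrier K) → ¬ (Group._≈_ K w (Group.ε K)) →
    IsDSRG (Cay (S 2 ≀ K) (setY K w))
    (2 * n ^ 2) (4 * n ∸ 2) (2 * n + 2) (n + 2) 6
theorem3p3 (suc zero) (s≤s ())
-- Exposing two successors gives the order the form `2 + m` in which the counts are stated.
theorem3p3 (suc (suc m)) _ K I w w≉ε = record
  { order      = size-≀ K I
  ; loopless   = cay-loopless H Y
  ; out-degree = λ x → size-out H Y x (size-Y K w w≉ε I)
  ; in-degree  = λ x → size-in H Y x (size-Y K w w≉ε I)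
  ; undirected = λ x → size-paths H Y x x
      (size-Middle-resp H Y {h = x H.// x} {h′ = H.ε} (H.inverseʳ x) (size-Middle-ε K w w≉ε I))
  ; paths-arc  = λ x y _ x⟶y → size-paths H Y x y (size-Middle-∈ K w w≉ε I (y H.// x) x⟶y)
  ; paths-none = λ x y x≉y x⟶̸y → size-paths H Y x y (size-Middle-∉ K w w≉ε (y H.// x)
      (λ y//x≈ε → x≉y (H.sym {y} {x} (x∙y⁻¹≈ε⇒x≈y y x y//x≈ε))) x⟶̸y)
  }
  where
  H = S 2 ≀ K
  Y = setY K w
  module H = Group H
  open GroupProperties H using (x∙y⁻¹≈ε⇒x≈y)
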